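{- Let $\mathcal{D}=(\mathcal{P},\mathcal{B})$ be a non-trivial $2$-$(v,3,\lambda)$ design with $v\equiv 1,3\pmod{6}$ and $v\equiv 6\pmod{\lambda}$, admitting a flag-transitive automorphism group $G$ that acts $2$-transitively on $\mathcal{P}$. If $G$ is of affine type, then $\mathcal{D}\cong AG_h(3)$ for some $h$. -}

module Defs where

open import Data.Nat using (ℕ; zero; suc; _<_; _%_; NonZero)
open import Data.Nat.Primality using (Prime)
open import Data.Fin using (Fin; zero; suc)
open import Data.Fin.Subset using (Subset; _∈_; ∣_∣)
open import Data.Fin.Permutation using (Permutation′; _⟨$⟩ʳ_; _⟨$⟩ˡ_; _≈_; id; flip; _∘ₚ_)
open import Data.Vec using (Vec; tabulate; lookup; zipWith; replicate)
open import Data.List using (List; length; filter)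
import Data.List.Membership.Propositional as LM
open import Data.List.Relation.Unary.Unique.Propositional using (Unique)
open import Data.Product using (Σ; ∃; ∃-syntax; _×_; _,_)
open import Data.Sum using (_⊎_)
open import Relation.Binary.PropositionalEquality using (_≡_; _≢_)
open import Relation.Nullary using (¬_)
open import Relation.Nullary.Decidable using (_×-dec_)
open import Data.Fin.Subset.Properties using (_∈?_)
open import Function.Bundles using (_↔_; _⇔_)
open import Level using (0ℓ) renaming (suc to lsuc)

record Design (v k lam : ℕ) : Set where
  field
    blocks      : List (Subset v)
    blocksUnique : Unique blocks
    blockSize   : ∀ {b} → b LM.∈ blocks → ∣ b ∣ ≡ k
    balanced    : ∀ (x y : Fin v) → x ≢ y →
                  length (filter (λ b → (x ∈? b) ×-dec (y ∈? b)) blocks) ≡ lam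

NonTrivial : ℕ → ℕ → Set
NonTrivial v k = 2 < k × suc k < v

Perm : ℕ → Set
Perm v = Permutation′ v

image : ∀ {v} → Perm v → Subset v → Subset v
image σ b = tabulate (λ j → lookup b (σ ⟨$⟩ˡ j))

record PermGroup (v : ℕ) : Set₁ where
  field
    mem     : Perm v → Set
    mem-resp : ∀ {σ τ} → σ ≈ τ → mem σ → mem τ
    mem-id  : mem id
    mem-∘   : ∀ {σ τ} → mem σ → mem τ → mem (σ ∘ₚ τ)
    mem-inv : ∀ {σ} → mem σ → mem (flip σ)

open PermGroup public

_^ₚ_ : ∀ {v} → Perm v → ℕ → Perm v
σ ^ₚ zero = id
σ ^ₚ suc n = σ ∘ₚ (σ ^ₚ n)

module _ {v k lam : ℕ} (D : Design v k lam) where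
  open Design D

  IsAutomorphism : Perm v → Set
  IsAutomorphism σ = ∀ {b} → b LM.∈ blocks → image σ b LM.∈ blocks

  IsAutGroup : PermGroup v → Set
  IsAutGroup G = ∀ {σ} → mem G σ → IsAutomorphism σ

  FlagTransitive : PermGroup v → Set
  FlagTransitive G =
    ∀ (x y : Fin v) (b c : Subset v) →
    b LM.∈ blocks → x ∈ b → c LM.∈ blocks → y ∈ c →
    ∃[ g ] (mem G g × g ⟨$⟩ʳ x ≡ y × image g b ≡ c)

TwoTransitive : ∀ {v} → PermGroup v → Set
TwoTransitive {v} G =
  ∀ (x y x′ y′ : Fin v) → x ≢ y → x′ ≢ y′ →
  ∃[ g ] (mem G g × g ⟨$⟩ʳ x ≡ x′ × g ⟨$⟩ʳ y ≡ y′)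

IsNormalSubgroup : ∀ {v} → PermGroup v → PermGroup v → Set
IsNormalSubgroup G N =
  (∀ {σ} → mem N σ → mem G σ) ×
  (∀ {g n} → mem G g → mem N n → mem N ((flip g ∘ₚ n) ∘ₚ g))

IsRegular : ∀ {v} → PermGroup v → Set
IsRegular {v} N =
  (∀ (x y : Fin v) → ∃[ n ] (mem N n × n ⟨$⟩ʳ x ≡ y)) ×
  (∀ {n} (x : Fin v) → mem N n → n ⟨$⟩ʳ x ≡ x → n ≈ id)

IsElementaryAbelian : ∀ {v} → PermGroup v → Set
IsElementaryAbelian N =
  (∀ {σ τ} → mem N σ → mem N τ → (σ ∘ₚ τ) ≈ (τ ∘ₚ σ)) ×
  (∃[ p ] (Prime p × (∀ {σ} → mem N σ → (σ ^ₚ p) ≈ id)))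

AffineType : ∀ {v} → PermGroup v → Set₁
AffineType G =
  ∃[ N ] (IsNormalSubgroup G N × IsRegular N × IsElementaryAbelian N)

_+₃_ : Fin 3 → Fin 3 → Fin 3
zero +₃ b = b
suc zero +₃ zero = suc zero
suc zero +₃ suc zero = suc (suc zero)
suc zero +₃ suc (suc zero) = zero
suc (suc zero) +₃ zero = suc (suc zero)
suc (suc zero) +₃ suc zero = zero
suc (suc zero) +₃ suc (suc zero) = suc zero

F3^ : ℕ → Set
F3^ h = Vec (Fin 3) h

_⊕_ : ∀ {h} → F3^ h → F3^ h → F3^ h
_⊕_ = zipWith _+₃_

𝟎 : ∀ {h} → F3^ h
𝟎 = replicate _ zero

IsLine : (h : ℕ) → (F3^ h → Set) → Set
IsLine h S = ∃[ a ] ∃[ d ] (d ≢ 𝟎 ×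
  (∀ p → (S p → (p ≡ a ⊎ p ≡ a ⊕ d ⊎ p ≡ (a ⊕ d) ⊕ d))
       × ((p ≡ a ⊎ p ≡ a ⊕ d ⊎ p ≡ (a ⊕ d) ⊕ d) → S p)))

IsoAG3 : ∀ {v k lam} → Design v k lam → ℕ → Set
IsoAG3 {v} D h = Σ (Fin v ↔ F3^ h) λ φ →
  ∀ (b : Subset v) →
    (b LM.∈ Design.blocks D → IsLine h (λ p → Inverse.from φ p ∈ b)) ×
    (IsLine h (λ p → Inverse.from φ p ∈ b) → b LM.∈ Design.blocks D)
  where open import Function.Bundles using (Inverse)

{-# OPTIONS --safe #-}

-- The regular elementary abelian subgroup N turns the points into an abelian
-- group, of odd order because v is odd, on which G acts by affine maps; λ is odd
-- as well.  Count the incidences y ∈ b over the blocks b through x and -x, x ≢ o.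
-- If no such block contained o, the stabiliser of o would give every y ≢ o the
-- same number of incidences, hence 3λ of them; but x ↦ -x pairs them off, so λ
-- would be even.  Hence {o, x, -x} is a block for every x ≢ o.  A flag
-- automorphism taking o to x inside this block forces 3x = o, and every block,
-- being an image of {o, x, -x}, is then a line {a, a+u, a+2u}.
module Submission where

open import Defs
open import Data.Bool using (if_then_else_)
open import Data.Empty using (⊥)
open import Data.Nat using (ℕ; zero; suc; _<_; _%_; _/_; NonZero; s≤s; z≤n)
open import Data.Nat.Divisibility using (_∣_; _∣?_; divides; ∣m∣n⇒∣m+n; %-presˡ-∣; ∣n⇒∣m*n)
open import Data.Nat.DivMod using (m≡m%n+[m/n]*n)
open import Data.Nat.ListAction using () renaming (sum to sumᴸ)
open import Data.Nat.ListAction.Properties using (sum-↭)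
open import Data.Nat.Primality using (prime?; euclidsLemma)
import Data.Nat.Properties as ℕ
open import Data.Nat.Tactic.RingSolver using (solve-∀)
open import Data.Fin as Fin using (Fin; zero; suc)
import Data.Fin.Properties as Fin
open import Data.Fin.Permutation
  using (Permutation′; permutation; _⟨$⟩ʳ_; _⟨$⟩ˡ_; inverseˡ; inverseʳ; _≈_; flip; _∘ₚ_)
open import Data.Fin.Subset using (Subset; inside; outside; _∈_; ∣_∣) renaming (_-_ to _∖_)
open import Data.Fin.Subset.Properties
  using (_∈?_; nonempty?; Empty-unique; ∣⊥∣≡0; ⊆-antisym; x∈p∧x≢y⇒x∈p-y; x∈p⇒∣p-x∣<∣p∣)
open import Data.List as List using (List; []; _∷_; length; filter)
open import Data.List.Membership.Propositional using (find; lose) renaming (_∈_ to _∈ᴸ_)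
open import Data.List.Membership.Propositional.Properties using (∈-allFin; ∈-map⁺; ∈-map⁻)
open import Data.List.Membership.Propositional.Properties.WithK using (unique∧set⇒bag)
open import Data.List.Properties using (map-cong-local; map-cong; map-∘)
open import Data.List.Relation.Binary.BagAndSetEquality using (∼bag⇒↭)
open import Data.List.Relation.Binary.Permutation.Propositional using (_↭_)
open import Data.List.Relation.Binary.Permutation.Propositional.Properties using (map⁺)
import Data.List.Relation.Unary.All as All
open import Data.List.Relation.Unary.Any using (any?)
import Data.List.Relation.Unary.Unique.Propositional.Properties as Unique
open import Data.Product using (Σ; ∃-syntax; _×_; _,_; proj₁; proj₂)
open import Data.Sum using (_⊎_; inj₁; inj₂)
open import Data.Vec as Vec using (Vec; []; _∷_; lookup)
open import Data.Vec.Properties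
  using (lookup∘tabulate; tabulate∘lookup; tabulate-cong; []=⇒lookup; lookup⇒[]=)
open import Function using (_∘_)
open import Function.Bundles using (_↔_; Inverse; mk↔ₛ′; mk⇔)
open import Relation.Binary.Definitions using (tri<; tri≈; tri>)
open import Relation.Binary.PropositionalEquality
open import Relation.Nullary using (Dec; yes; no; does; ¬_; contradiction)
open import Relation.Nullary.Decidable using (_×-dec_; map′; from-yes; from-no; dec-true; dec-false)
open import Algebra.Bundles using (AbelianGroup)
open import Algebra.Structures using (IsAbelianGroup)
import Algebra.Properties.AbelianGroup as AbelianGroupProperties
import Algebra.Properties.CommutativeSemigroup as CommutativeSemigroupProperties
import Algebra.Properties.Group as GroupProperties
import Algebra.Properties.Semiring.Sum as SemiringSum

open ≡-Reasoning

private variable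
  n v : ℕ

⟨$⟩ʳ-injective : (g : Permutation′ v) {x y : Fin v} → g ⟨$⟩ʳ x ≡ g ⟨$⟩ʳ y → x ≡ y
⟨$⟩ʳ-injective g eq = trans (sym (inverseˡ g)) (trans (cong (g ⟨$⟩ˡ_) eq) (inverseˡ g))

-- Parity of sums under involutions, and double counting of incidences.

module Counting where

  open import Data.Nat using (_+_; _*_; _≤_; ≢-nonZero)
  open SemiringSum ℕ.+-*-semiring
    using (sum; sum-cong-≗; sum-permute; sum-replicate-zero; ∑-distrib-+; ∑-comm; *-distribˡ-sum; *-distribʳ-sum)

  when_then_ : ∀ {P : Set} → Dec P → ℕ → ℕ
  when d then m = if does d then m else 0

  when-true : ∀ {P : Set} (d : Dec P) {m} → P → when d then m ≡ m
  when-true d {m} p = cong (if_then m else 0) (dec-true d p)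

  when-false : ∀ {P : Set} (d : Dec P) {m} → ¬ P → when d then m ≡ 0
  when-false d {m} ¬p = cong (if_then m else 0) (dec-false d ¬p)

  -- A fixed point adds nothing, and a two-element orbit adds the same value at its smaller and at
  -- its larger point. Comparing `x` with its image splits the sum into these two halves, which `π`
  -- exchanges.
  involution⇒2∣sum : (π : Permutation′ n) (f : Fin n → ℕ) →
                     (∀ x → π ⟨$⟩ʳ (π ⟨$⟩ʳ x) ≡ x) →
                     (∀ x → f (π ⟨$⟩ʳ x) ≡ f x) →
                     (∀ x → π ⟨$⟩ʳ x ≡ x → f x ≡ 0) →
                     2 ∣ sum f
  involution⇒2∣sum π f invol f-invariant f-fixed = divides (sum below) (begin
    sum f                                  ≡⟨ sum-cong-≗ split ⟩
    sum (λ x → below x + above x)          ≡⟨ ∑-distrib-+ below above ⟩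
    sum below + sum above                  ≡⟨ cong (sum below +_) (sum-permute above π) ⟩
    sum below + sum (above ∘ (π ⟨$⟩ʳ_))    ≡⟨ cong (sum below +_) (sum-cong-≗ swap) ⟩
    sum below + sum below                  ≡⟨ m+m≡m*2 (sum below) ⟩
    sum below * 2                          ∎)
    where
    m+m≡m*2 : ∀ m → m + m ≡ m * 2
    m+m≡m*2 = solve-∀

    below above : Fin _ → ℕ
    below x = when x Fin.<? (π ⟨$⟩ʳ x) then f x
    above x = when (π ⟨$⟩ʳ x) Fin.<? x then f x

    split : ∀ x → f x ≡ below x + above x
    split x with Fin.<-cmp x (π ⟨$⟩ʳ x)
    ... | tri< lt _ ngt = sym (trans (cong₂ _+_ (when-true (_ Fin.<? _) lt) (when-false (_ Fin.<? _) ngt)) (ℕ.+-identityʳ _))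
    ... | tri≈ nlt eq ngt = trans (f-fixed x (sym eq)) (sym (cong₂ _+_ (when-false (_ Fin.<? _) nlt) (when-false (_ Fin.<? _) ngt)))
    ... | tri> nlt _ gt = sym (cong₂ _+_ (when-false (_ Fin.<? _) nlt) (when-true (_ Fin.<? _) gt))

    swap : ∀ x → above (π ⟨$⟩ʳ x) ≡ below x
    swap x = cong₂ (λ y m → when y Fin.<? (π ⟨$⟩ʳ x) then m) (invol x) (f-invariant x)

  fixed-point-free-involution⇒2∣ : (π : Permutation′ n) → (∀ x → π ⟨$⟩ʳ (π ⟨$⟩ʳ x) ≡ x) →
                                   (∀ x → π ⟨$⟩ʳ x ≢ x) → 2 ∣ n
  fixed-point-free-involution⇒2∣ {n} π invol free =
    subst (2 ∣_) (sum-1 n) (involution⇒2∣sum π (λ _ → 1) invol (λ _ → refl) (λ x eq → contradiction eq (free x)))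
    where
    sum-1 : ∀ n → sum {n} (λ _ → 1) ≡ n
    sum-1 zero    = refl
    sum-1 (suc n) = cong suc (sum-1 n)

  χ : Subset n → Fin n → ℕ
  χ b x = if lookup b x then 1 else 0

  χ-∈ : ∀ (b : Subset n) {x} → x ∈ b → χ b x ≡ 1
  χ-∈ b x∈b = cong (if_then 1 else 0) ([]=⇒lookup x∈b)

  χ-∉ : ∀ (b : Subset n) {x} → ¬ x ∈ b → χ b x ≡ 0
  χ-∉ b {x} x∉b with lookup b x in eq
  ... | inside  = contradiction (lookup⇒[]= x b eq) x∉b
  ... | outside = refl

  sum-χ : (b : Subset n) → sum (χ b) ≡ ∣ b ∣
  sum-χ []            = refl
  sum-χ (inside  ∷ b) = cong suc (sum-χ b)
  sum-χ (outside ∷ b) = sum-χ b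

  χ-image : (g : Permutation′ n) (b : Subset n) (x : Fin n) → χ (image g b) (g ⟨$⟩ʳ x) ≡ χ b x
  χ-image g b x = cong (if_then 1 else 0)
    (trans (lookup∘tabulate _ (g ⟨$⟩ʳ x)) (cong (lookup b) (inverseˡ g)))

  ∑ᴸ : {A : Set} → List A → (A → ℕ) → ℕ
  ∑ᴸ bs w = sumᴸ (List.map w bs)

  ∑ᴸ-cong-local : ∀ {A : Set} {bs : List A} {w w′ : A → ℕ} →
                  (∀ {b} → b ∈ᴸ bs → w b ≡ w′ b) → ∑ᴸ bs w ≡ ∑ᴸ bs w′
  ∑ᴸ-cong-local eq = cong sumᴸ (map-cong-local (All.tabulate eq))

  ∑ᴸ-sum-comm : ∀ {A : Set} (bs : List A) (w : A → Fin n → ℕ) →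
                sum (λ y → ∑ᴸ bs (λ b → w b y)) ≡ ∑ᴸ bs (λ b → sum (w b))
  ∑ᴸ-sum-comm {n} []       w = sum-replicate-zero n
  ∑ᴸ-sum-comm     (b ∷ bs) w =
    trans (∑-distrib-+ (w b) _) (cong (sum (w b) +_) (∑ᴸ-sum-comm bs w))

  *-distribʳ-∑ᴸ : ∀ {A : Set} (bs : List A) (w : A → ℕ) k → ∑ᴸ bs (λ b → w b * k) ≡ ∑ᴸ bs w * k
  *-distribʳ-∑ᴸ []       w k = refl
  *-distribʳ-∑ᴸ (b ∷ bs) w k =
    trans (cong (w b * k +_) (*-distribʳ-∑ᴸ bs w k)) (sym (ℕ.*-distribʳ-+ k (w b) _))

  length-filter-pair : (x y : Fin n) (bs : List (Subset n)) →
    length (filter (λ b → (x ∈? b) ×-dec (y ∈? b)) bs) ≡ ∑ᴸ bs (λ b → χ b x * χ b y)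
  length-filter-pair x y [] = refl
  length-filter-pair x y (b ∷ bs) with ih ← length-filter-pair x y bs | x ∈? b | y ∈? b
  ... | yes x∈b | yes y∈b = cong₂ _+_ (sym (cong₂ _*_ (χ-∈ b x∈b) (χ-∈ b y∈b))) ih
  ... | yes x∈b | no  y∉b = cong₂ _+_ (sym (cong₂ _*_ (χ-∈ b x∈b) (χ-∉ b y∉b))) ih
  ... | no  x∉b | _       = cong₂ _+_ (sym (cong (_* χ b y) (χ-∉ b x∉b))) ih

  -- `ν` stands for negation about the origin `o`, and `transitive` for the stabiliser of `o`, whose
  -- elements commute with `ν` and permute the blocks. `avoids` is the assumption to be refuted for
  -- odd `lam`.
  module _ {v lam : ℕ} (blocks : List (Subset v))
    (blockSize : ∀ {b} → b ∈ᴸ blocks → ∣ b ∣ ≡ 3)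
    (balanced : ∀ (x y : Fin v) → x ≢ y →
                length (filter (λ b → (x ∈? b) ×-dec (y ∈? b)) blocks) ≡ lam)
    (o : Fin v) (ν : Permutation′ v)
    (ν-invol : ∀ x → ν ⟨$⟩ʳ (ν ⟨$⟩ʳ x) ≡ x)
    (ν-o : ν ⟨$⟩ʳ o ≡ o)
    (ν-free : ∀ x → ν ⟨$⟩ʳ x ≡ x → x ≡ o)
    (transitive : ∀ y y′ → y ≢ o → y′ ≢ o →
      ∃[ g ] (g ⟨$⟩ʳ o ≡ o × g ⟨$⟩ʳ y ≡ y′
            × (∀ x → g ⟨$⟩ʳ (ν ⟨$⟩ʳ x) ≡ ν ⟨$⟩ʳ (g ⟨$⟩ʳ x))
            × List.map (image g) blocks ↭ blocks))
    (y₀ : Fin v) (y₀≢o : y₀ ≢ o)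
    (avoids : ∀ {b x} → x ≢ o → b ∈ᴸ blocks → x ∈ b → ν ⟨$⟩ʳ x ∈ b → ¬ o ∈ b)
    where

    private
      -- This weight removes `o`, the only fixed point of `ν`, from sums over all points. For the
      -- remaining `x` the points `x` and `ν x` are distinct, so `balanced` applies to them.
      ε : Fin v → ℕ
      ε x = if does (x Fin.≟ o) then 0 else 1

      ε-o : ∀ {x} → x ≡ o → ε x ≡ 0
      ε-o {x} eq = cong (if_then 0 else 1) (dec-true (x Fin.≟ o) eq)

      ε-≢ : ∀ {x} → x ≢ o → ε x ≡ 1
      ε-≢ {x} neq = cong (if_then 0 else 1) (dec-false (x Fin.≟ o) neq)

      ε-resp : (g : Permutation′ v) → g ⟨$⟩ʳ o ≡ o → ∀ x → ε (g ⟨$⟩ʳ x) ≡ ε x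
      ε-resp g g-o x with x Fin.≟ o
      ... | yes refl = ε-o g-o
      ... | no x≢o  = ε-≢ λ gx≡o → x≢o (⟨$⟩ʳ-injective g (trans gx≡o (sym g-o)))

      t : Fin v → Fin v → Subset v → ℕ
      t x y b = χ b x * χ b (ν ⟨$⟩ʳ x) * χ b y

      T : Fin v → Fin v → ℕ
      T x y = ε x * ∑ᴸ blocks (t x y)

      -- The number of pairs of a point `x` other than `o` and a block through `x`, `ν x` and `y`.
      W : Fin v → ℕ
      W y = sum (λ x → T x y)

      T-ν : ∀ x y → T (ν ⟨$⟩ʳ x) y ≡ T x y
      T-ν x y = cong₂ _*_ (ε-resp ν ν-o x) (cong sumᴸ (map-cong (λ b → cong (_* χ b y)
        (trans (cong (λ z → χ b (ν ⟨$⟩ʳ x) * χ b z) (ν-invol x)) (ℕ.*-comm (χ b (ν ⟨$⟩ʳ x)) (χ b x)))) blocks))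

      2∣W : ∀ y → 2 ∣ W y
      2∣W y = involution⇒2∣sum ν (λ x → T x y) ν-invol (λ x → T-ν x y)
                (λ x eq → cong (_* ∑ᴸ blocks (t x y)) (ε-o (ν-free x eq)))

      -- Take `g` fixing `o` with `y` going to `y′`. Reindexing the points by `g` and the blocks by
      -- `image g` turns one count into the other, since `g` commutes with `ν`.
      W-const : ∀ y y′ → y ≢ o → y′ ≢ o → W y′ ≡ W y
      W-const y y′ y≢o y′≢o with g , g-o , refl , g-ν , perm ← transitive y y′ y≢o y′≢o =
        trans (sum-permute (λ x → T x (g ⟨$⟩ʳ y)) g) (sum-cong-≗ λ x → cong₂ _*_ (ε-resp g g-o x) (begin
          ∑ᴸ blocks (t (g ⟨$⟩ʳ x) (g ⟨$⟩ʳ y))                         ≡⟨ sum-↭ (map⁺ _ perm) ⟨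
          ∑ᴸ (List.map (image g) blocks) (t (g ⟨$⟩ʳ x) (g ⟨$⟩ʳ y))    ≡⟨ cong sumᴸ (map-∘ blocks) ⟨
          ∑ᴸ blocks (λ b → t (g ⟨$⟩ʳ x) (g ⟨$⟩ʳ y) (image g b))       ≡⟨ cong sumᴸ (map-cong (λ b →
              cong₂ _*_ (cong₂ _*_ (χ-image g b x)
                (trans (cong (χ (image g b)) (sym (g-ν x))) (χ-image g b _))) (χ-image g b y)) blocks) ⟩
          ∑ᴸ blocks (t x y)                                           ∎))

      T-o : ∀ x → T x o ≡ 0
      T-o x with x Fin.≟ o
      ... | yes x≡o = refl
      ... | no x≢o = trans (ℕ.+-identityʳ _) (trans (∑ᴸ-cong-local {w′ = λ _ → 0} vanish) (zeros blocks))
        where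
        vanish : ∀ {b} → b ∈ᴸ blocks → t x o b ≡ 0
        vanish {b} b∈ with x ∈? b | (ν ⟨$⟩ʳ x) ∈? b
        ... | no x∉b | _ = cong (λ m → m * χ b (ν ⟨$⟩ʳ x) * χ b o) (χ-∉ b x∉b)
        ... | yes _ | no νx∉b = cong (_* χ b o) (trans (cong (χ b x *_) (χ-∉ b νx∉b)) (ℕ.*-zeroʳ (χ b x)))
        ... | yes x∈b | yes νx∈b = trans (cong (χ b x * χ b (ν ⟨$⟩ʳ x) *_) (χ-∉ b (avoids x≢o b∈ x∈b νx∈b)))
                                         (ℕ.*-zeroʳ (χ b x * χ b (ν ⟨$⟩ʳ x)))
        zeros : ∀ {A : Set} (bs : List A) → ∑ᴸ bs (λ _ → 0) ≡ 0
        zeros []       = refl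
        zeros (_ ∷ bs) = zeros bs

      W-o : W o ≡ 0
      W-o = trans (sum-cong-≗ T-o) (sum-replicate-zero v)

      -- For `x` other than `o` there are `lam` blocks through `x` and `ν x`, and each of them
      -- contributes its three points `y`.
      sum-T : ∀ x → sum (T x) ≡ ε x * (lam * 3)
      sum-T x = trans (sym (*-distribˡ-sum (ε x) (λ y → ∑ᴸ blocks (t x y)))) (by-cases (x Fin.≟ o))
        where
        by-cases : Dec (x ≡ o) → ε x * sum (λ y → ∑ᴸ blocks (t x y)) ≡ ε x * (lam * 3)
        by-cases (yes x≡o) = trans (cong (_* sum (λ y → ∑ᴸ blocks (t x y))) (ε-o x≡o)) (sym (cong (_* (lam * 3)) (ε-o x≡o)))
        by-cases (no  x≢o) = cong (ε x *_) (begin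
          sum (λ y → ∑ᴸ blocks (t x y))                       ≡⟨ ∑ᴸ-sum-comm blocks (λ b y → t x y b) ⟩
          ∑ᴸ blocks (λ b → sum (λ y → t x y b))               ≡⟨ ∑ᴸ-cong-local (λ {b} b∈ →
              trans (sym (*-distribˡ-sum (χ b x * χ b (ν ⟨$⟩ʳ x)) (χ b)))
                    (cong (χ b x * χ b (ν ⟨$⟩ʳ x) *_) (trans (sum-χ b) (blockSize b∈)))) ⟩
          ∑ᴸ blocks (λ b → χ b x * χ b (ν ⟨$⟩ʳ x) * 3)        ≡⟨ *-distribʳ-∑ᴸ blocks _ 3 ⟩
          ∑ᴸ blocks (λ b → χ b x * χ b (ν ⟨$⟩ʳ x)) * 3        ≡⟨ cong (_* 3) (trans
              (sym (length-filter-pair x (ν ⟨$⟩ʳ x) blocks)) (balanced x (ν ⟨$⟩ʳ x) (x≢o ∘ ν-free x ∘ sym))) ⟩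
          lam * 3                                             ∎)

      W≡ε*W : ∀ y → W y ≡ ε y * W y₀
      W≡ε*W y with y Fin.≟ o
      ... | yes refl = W-o
      ... | no y≢o = trans (W-const y₀ y y₀≢o y≢o) (sym (ℕ.+-identityʳ _))

      instance
        sum-ε≢0 : NonZero (sum ε)
        sum-ε≢0 = ≢-nonZero λ eq → contradiction (trans (sym (ε-≢ y₀≢o)) (ℕ.n≤0⇒n≡0 (subst (ε y₀ ≤_) eq (term≤sum ε y₀)))) λ ()
          where
          term≤sum : ∀ {n} (f : Fin n → ℕ) i → f i ≤ sum f
          term≤sum f zero    = ℕ.m≤m+n _ _
          term≤sum f (suc i) = ℕ.m≤n⇒m≤o+n (f zero) (term≤sum (f ∘ suc) i)

      -- Summing over `y` first or over `x` first gives `sum ε` times either side: `W` vanishes at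
      -- `o` by `avoids` and is constant elsewhere. The factor `sum ε` is nonzero because `y₀`
      -- contributes 1.
      W≡3λ : W y₀ ≡ lam * 3
      W≡3λ = ℕ.*-cancelˡ-≡ _ _ (sum ε) (begin
        sum ε * W y₀                  ≡⟨ *-distribʳ-sum (W y₀) ε ⟩
        sum (λ y → ε y * W y₀)        ≡⟨ sum-cong-≗ W≡ε*W ⟨
        sum (λ y → W y)               ≡⟨ ∑-comm (λ y x → T x y) ⟩
        sum (λ x → sum (T x))         ≡⟨ sum-cong-≗ sum-T ⟩
        sum (λ x → ε x * (lam * 3))   ≡⟨ *-distribʳ-sum (lam * 3) ε ⟨
        sum ε * (lam * 3)             ∎)

    -- Pairing `x` with `ν x` makes `W y₀` even, and 2 is a prime not dividing 3.
    no-symmetric-blocks⇒2∣λ : 2 ∣ lam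
    no-symmetric-blocks⇒2∣λ with euclidsLemma lam 3 (from-yes (prime? 2)) (subst (2 ∣_) W≡3λ (2∣W y₀))
    ... | inj₁ 2∣lam = 2∣lam
    ... | inj₂ (divides (suc zero) ())
    ... | inj₂ (divides (suc (suc _)) ())

-- Linear algebra over the field of three elements.

⊕-𝟎 : ∀ {h} → 𝟎 ⊕ 𝟎 ≡ 𝟎 {h}
⊕-𝟎 {zero}  = refl
⊕-𝟎 {suc h} = cong (zero ∷_) ⊕-𝟎

-- In characteristic 3, `q ⊕ q` is the negative of `q`, so the hypothesis says that the difference
-- of `p` and `q` vanishes.
p⊕q⊕q≡𝟎⇒p≡q : ∀ {h} (p q : F3^ h) → p ⊕ (q ⊕ q) ≡ 𝟎 → p ≡ q
p⊕q⊕q≡𝟎⇒p≡q []      []      _  = refl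
p⊕q⊕q≡𝟎⇒p≡q (c ∷ p) (d ∷ q) eq =
  cong₂ _∷_ (digit c d (cong Vec.head eq)) (p⊕q⊕q≡𝟎⇒p≡q p q (cong Vec.tail eq))
  where
  digit : ∀ c d → c +₃ (d +₃ d) ≡ zero → c ≡ d
  digit zero zero _ = refl
  digit (suc zero) (suc zero) _ = refl
  digit (suc (suc zero)) (suc (suc zero)) _ = refl
  digit zero (suc zero) ()
  digit zero (suc (suc zero)) ()
  digit (suc zero) zero ()
  digit (suc zero) (suc (suc zero)) ()
  digit (suc (suc zero)) zero ()
  digit (suc (suc zero)) (suc zero) ()

module Coordinates {v} {_+_ : Fin v → Fin v → Fin v} {0# : Fin v} { -_ : Fin v → Fin v}
  (isAbelianGroup : IsAbelianGroup _≡_ _+_ 0# -_)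
  (exponent-3 : ∀ x → (x + x) + x ≡ 0#) where

  private
    V : AbelianGroup _ _
    V = record { isAbelianGroup = isAbelianGroup }
  open AbelianGroup V using (group; commutativeSemigroup; assoc; identityˡ; identityʳ)
  open GroupProperties group using (∙-cancelˡ; ∙-cancelʳ; \\-leftDividesˡ; \\-leftDividesʳ)
  open CommutativeSemigroupProperties commutativeSemigroup using (interchange)

  _·_ : Fin 3 → Fin v → Fin v
  zero           · e = 0#
  suc zero       · e = e
  suc (suc zero) · e = e + e

  -- `exponent-3` enters exactly in the cases where the sum of the digits wraps around modulo 3.
  ·-distrib-+₃ : ∀ c d e → (c +₃ d) · e ≡ (c · e) + (d · e)
  ·-distrib-+₃ zero d e = sym (identityˡ _)
  ·-distrib-+₃ (suc zero) zero e = sym (identityʳ _)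
  ·-distrib-+₃ (suc zero) (suc zero) e = refl
  ·-distrib-+₃ (suc zero) (suc (suc zero)) e = sym (trans (sym (assoc e e e)) (exponent-3 e))
  ·-distrib-+₃ (suc (suc zero)) zero e = sym (identityʳ _)
  ·-distrib-+₃ (suc (suc zero)) (suc zero) e = sym (exponent-3 e)
  ·-distrib-+₃ (suc (suc zero)) (suc (suc zero)) e = sym (begin
    (e + e) + (e + e)   ≡⟨ assoc (e + e) e e ⟨
    ((e + e) + e) + e   ≡⟨ cong (_+ e) (exponent-3 e) ⟩
    0# + e              ≡⟨ identityˡ e ⟩
    e                   ∎)

  comb : ∀ {h} → Vec (Fin v) h → F3^ h → Fin v
  comb []       []      = 0#
  comb (e ∷ es) (c ∷ p) = (c · e) + comb es p

  comb-⊕ : ∀ {h} (es : Vec (Fin v) h) p q → comb es (p ⊕ q) ≡ comb es p + comb es q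
  comb-⊕ []       []      []      = sym (identityˡ 0#)
  comb-⊕ (e ∷ es) (c ∷ p) (d ∷ q) =
    trans (cong₂ _+_ (·-distrib-+₃ c d e) (comb-⊕ es p q)) (interchange _ _ _ _)

  comb-𝟎 : ∀ {h} (es : Vec (Fin v) h) → comb es 𝟎 ≡ 0#
  comb-𝟎 []       = refl
  comb-𝟎 (e ∷ es) = trans (identityˡ _) (comb-𝟎 es)

  Independent : ∀ {h} → Vec (Fin v) h → Set
  Independent es = ∀ p → comb es p ≡ 0# → p ≡ 𝟎

  Span : ∀ {h} → Vec (Fin v) h → Fin v → Set
  Span es a = ∃[ p ] comb es p ≡ a

  -- Only three leading coefficients are possible; each is tried by subtracting its multiple of `e`
  -- and deciding membership in the span of the rest.
  span? : ∀ {h} (es : Vec (Fin v) h) a → Dec (Span es a)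
  span? []       a = map′ (λ eq → [] , eq) (λ { ([] , eq) → eq }) (0# Fin.≟ a)
  span? (e ∷ es) a = map′
    (λ { (c , p , eq) → c ∷ p , trans (cong ((c · e) +_) eq) (\\-leftDividesˡ (c · e) a) })
    (λ { (c ∷ p , refl) → c , p , sym (\\-leftDividesʳ (c · e) (comb es p)) })
    (Fin.any? λ c → span? es ((- (c · e)) + a))

  span-∷ : ∀ {h} {es : Vec (Fin v) h} {e a} → Span es a → Span (e ∷ es) a
  span-∷ (p , eq) = zero ∷ p , trans (identityˡ _) eq

  -- Let `s` be the combination of `es` in a vanishing combination. A leading coefficient 1 gives
  -- `a` = -`s` = 2`s`, and 2 gives `a` = `s`; both put `a` in the span of `es`.
  independent-∷ : ∀ {h} {es : Vec (Fin v) h} {a} → Independent es → ¬ Span es a → Independent (a ∷ es)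
  independent-∷ indep a∉ (zero ∷ p) eq = cong (zero ∷_) (indep p (trans (sym (identityˡ _)) eq))
  independent-∷ {es = es} {a} indep a∉ (suc zero ∷ p) eq = contradiction
    (p ⊕ p , trans (comb-⊕ es p p) (∙-cancelʳ (comb es p) _ a (trans (exponent-3 _) (sym eq)))) a∉
  independent-∷ {a = a} indep a∉ (suc (suc zero) ∷ p) eq = contradiction
    (p , ∙-cancelˡ (a + a) _ a (trans eq (sym (exponent-3 a)))) a∉

  comb-injective : ∀ {h} {es : Vec (Fin v) h} → Independent es → ∀ p q → comb es p ≡ comb es q → p ≡ q
  comb-injective {es = es} indep p q eq = p⊕q⊕q≡𝟎⇒p≡q p q (indep _ (begin
    comb es (p ⊕ (q ⊕ q))                    ≡⟨ comb-⊕ es p (q ⊕ q) ⟩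
    comb es p + comb es (q ⊕ q)              ≡⟨ cong₂ _+_ eq (comb-⊕ es q q) ⟩
    comb es q + (comb es q + comb es q)      ≡⟨ assoc _ _ _ ⟨
    (comb es q + comb es q) + comb es q      ≡⟨ exponent-3 _ ⟩
    0#                                       ∎))

  -- Greedy choice of a basis: a point joins the vectors already chosen only if it lies outside
  -- their span.
  independent-spanning : (xs : List (Fin v)) →
    ∃[ h ] Σ (Vec (Fin v) h) λ es → Independent es × All.All (Span es) xs
  independent-spanning [] = 0 , [] , (λ { [] _ → refl }) , All.[]
  independent-spanning (x ∷ xs) with h , es , indep , spans ← independent-spanning xs | span? es x
  ... | yes x∈ = h , es , indep , x∈ All.∷ spans
  ... | no  x∉ = suc h , x ∷ es , independent-∷ indep x∉
               , (suc zero ∷ 𝟎 , trans (cong (x +_) (comb-𝟎 es)) (identityʳ x)) All.∷ All.map span-∷ spans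

  -- A basis is chosen from the list of all points: spanning provides coordinates and independence
  -- makes them unique.
  coordinates : ∃[ h ] Σ (Fin v ↔ F3^ h) λ φ → let open Inverse φ in
    (∀ p q → from (p ⊕ q) ≡ from p + from q) × from 𝟎 ≡ 0#
  coordinates with h , es , indep , spans ← independent-spanning (List.allFin v) =
    h , mk↔ₛ′ (λ a → proj₁ (span a)) (comb es)
          (λ p → comb-injective {es = es} indep _ p (proj₂ (span (comb es p))))
          (λ a → proj₂ (span a))
    , comb-⊕ es , comb-𝟎 es
    where
    span : ∀ a → Span es a
    span a = All.lookup spans (∈-allFin a)

-- Images of subsets, and subsets of size three.

image⁺ : (g : Permutation′ v) (b : Subset v) {x : Fin v} → x ∈ b → g ⟨$⟩ʳ x ∈ image g b
image⁺ g b {x} x∈b = lookup⇒[]= _ _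
  (trans (lookup∘tabulate _ (g ⟨$⟩ʳ x)) (trans (cong (lookup b) (inverseˡ g)) ([]=⇒lookup x∈b)))

image-flip : (g : Permutation′ v) (b : Subset v) → image g (image (flip g) b) ≡ b
image-flip g b = trans
  (tabulate-cong λ x → trans (lookup∘tabulate _ (g ⟨$⟩ˡ x)) (cong (lookup b) (inverseʳ g)))
  (tabulate∘lookup b)

image-injective : (g : Permutation′ v) {b c : Subset v} → image g b ≡ image g c → b ≡ c
image-injective g {b} {c} eq =
  trans (sym (image-flip (flip g) b)) (trans (cong (image (flip g)) eq) (image-flip (flip g) c))

3-subset-elements : ∀ {b : Subset v} {x y z w} → ∣ b ∣ ≡ 3 → x ≢ y → x ≢ z → y ≢ z →
                    x ∈ b → y ∈ b → z ∈ b → w ∈ b → w ≡ x ⊎ w ≡ y ⊎ w ≡ z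
3-subset-elements {b = b} {x} {y} {z} {w} size x≢y x≢z y≢z x∈ y∈ z∈ w∈
  with w Fin.≟ x | w Fin.≟ y | w Fin.≟ z
... | yes w≡x | _ | _ = inj₁ w≡x
... | no _ | yes w≡y | _ = inj₂ (inj₁ w≡y)
... | no _ | no _ | yes w≡z = inj₂ (inj₂ w≡z)
... | no w≢x | no w≢y | no w≢z = contradiction (subst (3 <_) size 3<∣b∣) (ℕ.<-irrefl refl)
  where
  y∈′ : y ∈ b ∖ x
  y∈′ = x∈p∧x≢y⇒x∈p-y y∈ (x≢y ∘ sym)

  z∈′ : z ∈ b ∖ x ∖ y
  z∈′ = x∈p∧x≢y⇒x∈p-y (x∈p∧x≢y⇒x∈p-y z∈ (x≢z ∘ sym)) (y≢z ∘ sym)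

  w∈′ : w ∈ b ∖ x ∖ y ∖ z
  w∈′ = x∈p∧x≢y⇒x∈p-y (x∈p∧x≢y⇒x∈p-y (x∈p∧x≢y⇒x∈p-y w∈ w≢x) w≢y) w≢z

  3<∣b∣ : 3 < ∣ b ∣
  -- Deleting the four distinct elements `x`, `y`, `z`, `w` in turn lowers the size strictly each
  -- time, starting from `b` and ending at size 0 or more.
  3<∣b∣ = ℕ.≤-<-trans (ℕ.≤-<-trans (ℕ.≤-<-trans (ℕ.≤-<-trans z≤n
    (x∈p⇒∣p-x∣<∣p∣ w∈′)) (x∈p⇒∣p-x∣<∣p∣ z∈′)) (x∈p⇒∣p-x∣<∣p∣ y∈′)) (x∈p⇒∣p-x∣<∣p∣ x∈)

-- The regular abelian group as a group structure on the points.

module Translations (N : PermGroup v) (regular : IsRegular N)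
  (commute : ∀ {σ τ} → mem N σ → mem N τ → (σ ∘ₚ τ) ≈ (τ ∘ₚ σ)) (o : Fin v) where

  τ : Fin v → Perm v
  τ a = proj₁ (proj₁ regular o a)

  τ∈N : ∀ a → mem N (τ a)
  τ∈N a = proj₁ (proj₂ (proj₁ regular o a))

  τ-o : ∀ a → τ a ⟨$⟩ʳ o ≡ a
  τ-o a = proj₂ (proj₂ (proj₁ regular o a))

  -- `m` followed by the inverse of `n` fixes `o`, hence is the identity by regularity. Every
  -- identity between translations can thus be checked at `o`.
  agree-at-o : ∀ {m n} → mem N m → mem N n → m ⟨$⟩ʳ o ≡ n ⟨$⟩ʳ o → m ≈ n
  agree-at-o {m} {n} m∈ n∈ eq x = begin
    m ⟨$⟩ʳ x                    ≡⟨ inverseʳ n ⟨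
    n ⟨$⟩ʳ (n ⟨$⟩ˡ (m ⟨$⟩ʳ x))  ≡⟨ cong (n ⟨$⟩ʳ_) (proj₂ regular o (mem-∘ N m∈ (mem-inv N n∈))
                                    (trans (cong (n ⟨$⟩ˡ_) eq) (inverseˡ n)) x) ⟩
    n ⟨$⟩ʳ x                    ∎

  _+_ : Fin v → Fin v → Fin v
  a + b = τ a ⟨$⟩ʳ b

  -_ : Fin v → Fin v
  - a = τ a ⟨$⟩ˡ o

  +-comm : ∀ a b → a + b ≡ b + a
  +-comm a b = begin
    τ a ⟨$⟩ʳ b              ≡⟨ cong (τ a ⟨$⟩ʳ_) (τ-o b) ⟨
    τ a ⟨$⟩ʳ (τ b ⟨$⟩ʳ o)   ≡⟨ commute (τ∈N b) (τ∈N a) o ⟩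
    τ b ⟨$⟩ʳ (τ a ⟨$⟩ʳ o)   ≡⟨ cong (τ b ⟨$⟩ʳ_) (τ-o a) ⟩
    τ b ⟨$⟩ʳ a              ∎

  +-assoc : ∀ a b c → (a + b) + c ≡ a + (b + c)
  +-assoc a b = agree-at-o (τ∈N (a + b)) (mem-∘ N (τ∈N b) (τ∈N a))
    (trans (τ-o (a + b)) (cong (τ a ⟨$⟩ʳ_) (sym (τ-o b))))

  +-identityʳ : ∀ a → a + o ≡ a
  +-identityʳ = τ-o

  +-inverseʳ : ∀ a → a + (- a) ≡ o
  +-inverseʳ a = inverseʳ (τ a)

  isAbelianGroup : IsAbelianGroup _≡_ _+_ o (-_)
  isAbelianGroup = record
    { isGroup = record
      { isMonoid = record
        { isSemigroup = record
          { isMagma = record { isEquivalence = isEquivalence ; ∙-cong = cong₂ _+_ }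
          ; assoc   = +-assoc
          }
        ; identity = (λ a → trans (+-comm o a) (+-identityʳ a)) , +-identityʳ
        }
      ; inverse = (λ a → trans (+-comm (- a) a) (+-inverseʳ a)) , +-inverseʳ
      ; ⁻¹-cong = cong -_
      }
    ; comm = +-comm
    }

  V : AbelianGroup _ _
  V = record { isAbelianGroup = isAbelianGroup }

-- Affine action on the design, symmetric blocks and lines.

module AffineDesign {v lam : ℕ} (D : Design v 3 lam) (2∤v : ¬ 2 ∣ v) (2∤λ : ¬ 2 ∣ lam)
  (G : PermGroup v) (aut : IsAutGroup D G) (flagTransitive : FlagTransitive D G)
  (twoTransitive : TwoTransitive G)
  (N : PermGroup v) (normal : IsNormalSubgroup G N) (regular : IsRegular N)
  (commute : ∀ {σ τ} → mem N σ → mem N τ → (σ ∘ₚ τ) ≈ (τ ∘ₚ σ))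
  (o x₀ : Fin v) (x₀≢o : x₀ ≢ o) where

  open Design D
  open Translations N regular commute o
  open Counting
  open AbelianGroup V using (group; identityˡ)
  open GroupProperties group using
    (∙-cancelˡ; ∙-cancelʳ; ⁻¹-involutive; ε⁻¹≈ε; inverseˡ-unique)
  open AbelianGroupProperties V using (xyx⁻¹≈y)

  x+y≡y⇒x≡o : ∀ {x y} → x + y ≡ y → x ≡ o
  x+y≡y⇒x≡o {x} {y} eq = ∙-cancelʳ y x o (trans eq (sym (identityˡ y)))

  -- Otherwise translation by `x` would be a fixed-point-free involution on an odd number of points.
  x+x≡o⇒x≡o : ∀ {x} → x + x ≡ o → x ≡ o
  x+x≡o⇒x≡o {x} x+x≡o with x Fin.≟ o
  ... | yes x≡o = x≡o
  ... | no  x≢o = contradiction (fixed-point-free-involution⇒2∣ (τ x)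
    (λ y → trans (sym (+-assoc x x y)) (trans (cong (_+ y) x+x≡o) (identityˡ y)))
    (λ y → x≢o ∘ x+y≡y⇒x≡o)) 2∤v

  x≡-x⇒x≡o : ∀ {x} → x ≡ - x → x ≡ o
  x≡-x⇒x≡o {x} eq = x+x≡o⇒x≡o (trans (cong (x +_) eq) (+-inverseʳ x))

  x≢o⇒-x≢o : ∀ {x} → x ≢ o → - x ≢ o
  x≢o⇒-x≢o {x} x≢o -x≡o = x≢o (trans (sym (⁻¹-involutive x)) (trans (cong -_ -x≡o) ε⁻¹≈ε))

  -- By normality the conjugate of `τ x` by `g` lies in `N`, so it is the translation by its value
  -- at `o`.
  conjugate-translation : ∀ {g} → mem G g → ∀ x →
    ∃[ u ] (∀ z → g ⟨$⟩ʳ (x + z) ≡ u + (g ⟨$⟩ʳ z))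
  conjugate-translation {g} g∈ x = c ⟨$⟩ʳ o , λ z → begin
    g ⟨$⟩ʳ (x + z)                          ≡⟨ cong (λ w → g ⟨$⟩ʳ (x + w)) (inverseˡ g) ⟨
    c ⟨$⟩ʳ (g ⟨$⟩ʳ z)                       ≡⟨ agree-at-o c∈ (τ∈N _) (sym (τ-o _)) (g ⟨$⟩ʳ z) ⟩
    (c ⟨$⟩ʳ o) + (g ⟨$⟩ʳ z)                 ∎
    where
    c : Perm v
    c = (flip g ∘ₚ τ x) ∘ₚ g
    c∈ : mem N c
    c∈ = proj₂ normal g∈ (τ∈N x)

  -- The identity of `conjugate-translation` is used at `o` and at `- x`; the latter reads
  -- `g ⟨$⟩ʳ o ≡ u + (g ⟨$⟩ʳ (- x))`. Injectivity of `g` excludes `u ≡ o`.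
  symmetric-images : ∀ {g} → mem G g → ∀ x → x ≢ o →
    ∃[ u ] (u ≢ o × g ⟨$⟩ʳ x ≡ (g ⟨$⟩ʳ o) + u × g ⟨$⟩ʳ (- x) ≡ (g ⟨$⟩ʳ o) + (- u))
  symmetric-images {g} g∈ x x≢o with u , shift ← conjugate-translation g∈ x = u
    , (λ u≡o → x≢o (x+y≡y⇒x≡o (⟨$⟩ʳ-injective g (trans (shift o) (trans (cong (_+ (g ⟨$⟩ʳ o)) u≡o) (identityˡ _))))))
    , (begin
      g ⟨$⟩ʳ x            ≡⟨ cong (g ⟨$⟩ʳ_) (+-identityʳ x) ⟨
      g ⟨$⟩ʳ (x + o)      ≡⟨ shift o ⟩
      u + (g ⟨$⟩ʳ o)      ≡⟨ +-comm u _ ⟩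
      (g ⟨$⟩ʳ o) + u      ∎)
    , (begin
      g ⟨$⟩ʳ (- x)                    ≡⟨ xyx⁻¹≈y u _ ⟨
      (u + (g ⟨$⟩ʳ (- x))) + (- u)    ≡⟨ cong (_+ (- u)) (shift (- x)) ⟨
      (g ⟨$⟩ʳ (x + (- x))) + (- u)    ≡⟨ cong (λ z → (g ⟨$⟩ʳ z) + (- u)) (+-inverseʳ x) ⟩
      (g ⟨$⟩ʳ o) + (- u)              ∎)

  fixes-o⇒odd : ∀ {g} → mem G g → g ⟨$⟩ʳ o ≡ o → ∀ x → g ⟨$⟩ʳ (- x) ≡ - (g ⟨$⟩ʳ x)
  fixes-o⇒odd {g} g∈ g-o x with x Fin.≟ o
  ... | yes refl = trans (cong (g ⟨$⟩ʳ_) ε⁻¹≈ε) (trans g-o (sym (trans (cong -_ g-o) ε⁻¹≈ε)))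
  ... | no x≢o with u , _ , gx , g-x ← symmetric-images g∈ x x≢o = begin
    g ⟨$⟩ʳ (- x)          ≡⟨ g-x ⟩
    (g ⟨$⟩ʳ o) + (- u)    ≡⟨ trans (cong (_+ (- u)) g-o) (identityˡ (- u)) ⟩
    - u                   ≡⟨ cong -_ (trans gx (trans (cong (_+ u) g-o) (identityˡ u))) ⟨
    - (g ⟨$⟩ʳ x)          ∎

  -- Both lists are free of duplicates and have the same members; surjectivity comes from the
  -- inverse of `g`, which is an automorphism too.
  map-image-↭ : ∀ {g} → mem G g → List.map (image g) blocks ↭ blocks
  map-image-↭ {g} g∈ = ∼bag⇒↭ (unique∧set⇒bag
    (Unique.map⁺ (image-injective g) blocksUnique) blocksUnique
    (mk⇔ (λ b∈ → let c , c∈ , eq = ∈-map⁻ (image g) b∈ in subst (_∈ᴸ blocks) (sym eq) (aut g∈ c∈))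
         covers))
    where
    covers : ∀ {b} → b ∈ᴸ blocks → b ∈ᴸ List.map (image g) blocks
    covers {b} b∈ = subst (_∈ᴸ List.map (image g) blocks) (image-flip g b)
                      (∈-map⁺ (image g) (aut (mem-inv G g∈) b∈))

  SymmetricBlock : Fin v → Subset v → Set
  SymmetricBlock x b = o ∈ b × x ∈ b × - x ∈ b

  -- An element of `G` fixing `o` and taking `x` to `y` also takes `- x` to `- y`.
  move-symmetric-block : ∀ {x y b} → x ≢ o → y ≢ o → b ∈ᴸ blocks → SymmetricBlock x b →
                         ∃[ c ] (c ∈ᴸ blocks × SymmetricBlock y c)
  move-symmetric-block {x} {y} {b} x≢o y≢o b∈ (o∈ , x∈ , -x∈)
    with g , g∈ , g-o , refl ← twoTransitive o x o y (x≢o ∘ sym) (y≢o ∘ sym) =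
      image g b , aut g∈ b∈
    , subst (_∈ image g b) g-o (image⁺ g b o∈)
    , image⁺ g b x∈
    , subst (_∈ image g b) (fixes-o⇒odd g∈ g-o x) (image⁺ g b -x∈)

  symmetric-block : ∀ x → x ≢ o → ∃[ b ] (b ∈ᴸ blocks × SymmetricBlock x b)
  symmetric-block x x≢o with any? (λ b → (o ∈? b) ×-dec ((x ∈? b) ×-dec ((- x) ∈? b))) blocks
  ... | yes has = find has
  ... | no hasn't = contradiction
    (no-symmetric-blocks⇒2∣λ blocks blockSize balanced o
      (permutation -_ -_ ⁻¹-involutive ⁻¹-involutive)
      ⁻¹-involutive ε⁻¹≈ε (λ x → x≡-x⇒x≡o ∘ sym)
      (λ y y′ y≢o y′≢o → let g , g∈ , g-o , gy = twoTransitive o y o y′ (y≢o ∘ sym) (y′≢o ∘ sym) in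
        g , g-o , gy , fixes-o⇒odd g∈ g-o , map-image-↭ g∈)
      x₀ x₀≢o
      -- A symmetric block at any `y` could be moved to `x`, so its absence at this one `x` gives
      -- `avoids` everywhere.
      (λ y≢o b∈ y∈ -y∈ o∈ → let c , c∈ , symm = move-symmetric-block y≢o x≢o b∈ (o∈ , y∈ , -y∈) in
        hasn't (lose c∈ symm)))
    2∤λ

  symmetric-block-elements : ∀ {x b w} → x ≢ o → b ∈ᴸ blocks → SymmetricBlock x b →
                             w ∈ b → w ≡ o ⊎ w ≡ x ⊎ w ≡ - x
  symmetric-block-elements {x} x≢o b∈ (o∈ , x∈ , -x∈) =
    3-subset-elements (blockSize b∈) (x≢o ∘ sym) (x≢o⇒-x≢o x≢o ∘ sym) (x≢o ∘ x≡-x⇒x≡o) o∈ x∈ -x∈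

  -- The two translates differ from each other, as `u` is not its own negative, and from `x`. So
  -- they are `o` and `- x` in some order, and either order forces `x + x ≡ - x`.
  opposite-translates⇒3x≡o : ∀ {x u} → x ≢ o → u ≢ o →
    x + u ≡ o ⊎ x + u ≡ x ⊎ x + u ≡ - x →
    x + (- u) ≡ o ⊎ x + (- u) ≡ x ⊎ x + (- u) ≡ - x → (x + x) + x ≡ o
  opposite-translates⇒3x≡o {x} {u} x≢o u≢o = conclude
    where
    distinct : ∀ {z} → x + u ≡ z → x + (- u) ≢ z
    distinct eq eq′ = u≢o (x≡-x⇒x≡o (∙-cancelˡ x u (- u) (trans eq (sym eq′))))

    x+w≢x : ∀ {w} → w ≢ o → x + w ≢ x
    x+w≢x {w} w≢o eq = w≢o (x+y≡y⇒x≡o (trans (+-comm w x) eq))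

    2x≡-x⇒3x≡o : ∀ {w} → w ≡ x → x + w ≡ - x → (x + x) + x ≡ o
    2x≡-x⇒3x≡o refl eq = trans (cong (_+ x) eq) (trans (+-comm (- x) x) (+-inverseʳ x))

    conclude : x + u ≡ o ⊎ x + u ≡ x ⊎ x + u ≡ - x →
               x + (- u) ≡ o ⊎ x + (- u) ≡ x ⊎ x + (- u) ≡ - x → (x + x) + x ≡ o
    conclude (inj₁ eq)        (inj₁ eq′)        = contradiction eq′ (distinct eq)
    conclude (inj₂ (inj₂ eq)) (inj₂ (inj₂ eq′)) = contradiction eq′ (distinct eq)
    conclude (inj₂ (inj₁ eq)) _                 = contradiction eq (x+w≢x u≢o)
    conclude _                (inj₂ (inj₁ eq′)) = contradiction eq′ (x+w≢x (x≢o⇒-x≢o u≢o))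
    conclude (inj₁ eq) (inj₂ (inj₂ eq′)) =
      2x≡-x⇒3x≡o (sym (inverseˡ-unique x u eq)) eq′
    conclude (inj₂ (inj₂ eq)) (inj₁ eq′) =
      2x≡-x⇒3x≡o (trans (sym (⁻¹-involutive u)) (sym (inverseˡ-unique x (- u) eq′))) eq

  -- Flag-transitivity gives `g` preserving the block of `o`, `x`, `- x` and taking `o` to `x`. It
  -- sends `x` and `- x` to `x + u` and `x + (- u)`, which lie in that block again.
  exponent-3 : ∀ x → (x + x) + x ≡ o
  exponent-3 x with x Fin.≟ o
  ... | yes refl = trans (cong (_+ o) (+-identityʳ o)) (+-identityʳ o)
  ... | no x≢o
    with b , b∈ , symm@(o∈ , x∈ , -x∈) ← symmetric-block x x≢o
    with g , g∈ , g-o , g-b ← flagTransitive o x b b b∈ o∈ b∈ x∈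
    with u , u≢o , gx , g-x ← symmetric-images g∈ x x≢o =
      opposite-translates⇒3x≡o x≢o u≢o (lands x∈ gx) (lands -x∈ g-x)
    where
    lands : ∀ {z w} → z ∈ b → g ⟨$⟩ʳ z ≡ (g ⟨$⟩ʳ o) + w → x + w ≡ o ⊎ x + w ≡ x ⊎ x + w ≡ - x
    lands {z} {w} z∈ eq = symmetric-block-elements x≢o b∈ symm
      (subst₂ _∈_ (trans eq (cong (_+ w) g-o)) g-b (image⁺ g b z∈))

  Line : Fin v → Fin v → Fin v → Set
  Line a u z = z ≡ a ⊎ z ≡ a + u ⊎ z ≡ (a + u) + u

  IsLineSubset : Subset v → Set
  IsLineSubset b = ∃[ a ] ∃[ u ] (u ≢ o × (∀ {z} → z ∈ b → Line a u z) × (∀ {z} → Line a u z → z ∈ b))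

  a-u≡a+u+u : ∀ a u → a + (- u) ≡ (a + u) + u
  a-u≡a+u+u a u = trans (cong (a +_) (sym (inverseˡ-unique (u + u) u (exponent-3 u)))) (sym (+-assoc a u u))

  x≢x+w : ∀ {x w} → w ≢ o → x ≢ x + w
  x≢x+w {x} {w} w≢o eq = w≢o (x+y≡y⇒x≡o (trans (+-comm w x) (sym eq)))

  -- By `exponent-3` the negative of `u` is `u + u`, so the three given points are those of the
  -- line; being distinct, they exhaust the block.
  block-is-line : ∀ {b a u} → u ≢ o → b ∈ᴸ blocks → a ∈ b → a + u ∈ b → a + (- u) ∈ b →
                  (∀ {z} → z ∈ b → Line a u z) × (∀ {z} → Line a u z → z ∈ b)
  block-is-line {b} {a} {u} u≢o b∈ a∈ a+u∈ a-u∈ =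
      3-subset-elements (blockSize b∈) (x≢x+w u≢o)
        (subst (a ≢_) (a-u≡a+u+u a u) (x≢x+w (x≢o⇒-x≢o u≢o))) (x≢x+w u≢o) a∈ a+u∈ a+2u∈
    , λ { (inj₁ refl) → a∈ ; (inj₂ (inj₁ refl)) → a+u∈ ; (inj₂ (inj₂ refl)) → a+2u∈ }
    where
    a+2u∈ : (a + u) + u ∈ b
    a+2u∈ = subst (_∈ b) (a-u≡a+u+u a u) a-u∈

  -- For any `a` in `b`, an element of `G` carries the symmetric block at `x₀` to `b` and `o` to
  -- `a`; the images of `x₀` and `- x₀` then have the form `a + u` and `a + (- u)`.
  block⇒line : ∀ {b} → b ∈ᴸ blocks → IsLineSubset b
  block⇒line {b} b∈ with nonempty? b
  ... | no empty = contradiction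
    (trans (sym (blockSize b∈)) (trans (cong ∣_∣ (Empty-unique empty)) (∣⊥∣≡0 v))) λ ()
  ... | yes (a , a∈)
    with c , c∈ , o∈ , x₀∈ , -x₀∈ ← symmetric-block x₀ x₀≢o
    with g , g∈ , refl , refl ← flagTransitive o a c b c∈ o∈ b∈ a∈
    with u , u≢o , gx₀ , g-x₀ ← symmetric-images g∈ x₀ x₀≢o =
      g ⟨$⟩ʳ o , u , u≢o , block-is-line u≢o b∈ a∈
        (subst (_∈ b) gx₀ (image⁺ g c x₀∈)) (subst (_∈ b) g-x₀ (image⁺ g c -x₀∈))

  -- The symmetric block at `u`, translated by `a`, is a block because `N` lies in `G`, and it has
  -- the same points as the line.
  line⇒block : ∀ {b} → IsLineSubset b → b ∈ᴸ blocks
  line⇒block {b} (a , u , u≢o , b⇒line , line⇒b)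
    with c , c∈ , o∈ , u∈ , -u∈ ← symmetric-block u u≢o = subst (_∈ᴸ blocks)
      (⊆-antisym (λ z∈ → line⇒b (proj₁ translated z∈)) (λ z∈ → proj₂ translated (b⇒line z∈))) moved
    where
    moved : image (τ a) c ∈ᴸ blocks
    moved = aut (proj₁ normal (τ∈N a)) c∈

    translated : (∀ {z} → z ∈ image (τ a) c → Line a u z) × (∀ {z} → Line a u z → z ∈ image (τ a) c)
    translated = block-is-line u≢o moved
      (subst (_∈ image (τ a) c) (+-identityʳ a) (image⁺ (τ a) c o∈)) (image⁺ (τ a) c u∈) (image⁺ (τ a) c -u∈)

  -- Transport of lines to coordinates.

  isoAG3 : ∃[ h ] IsoAG3 D h
  isoAG3 with h , φ , from-⊕ , from-𝟎 ← Coordinates.coordinates isAbelianGroup exponent-3 =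
    h , φ , λ b → isLine ∘ block⇒line , line⇒block ∘ isLineSubset
    where
    open Inverse φ using (to; from; strictlyInverseˡ; strictlyInverseʳ)

    from-injective : ∀ {p q} → from p ≡ from q → p ≡ q
    from-injective {p} {q} eq = trans (sym (strictlyInverseˡ p)) (trans (cong to eq) (strictlyInverseˡ q))

    from-⊕⊕ : ∀ p d → from ((p ⊕ d) ⊕ d) ≡ (from p + from d) + from d
    from-⊕⊕ p d = trans (from-⊕ (p ⊕ d) d) (cong (_+ from d) (from-⊕ p d))

    line⁻ : ∀ {a d p} → Line (from a) (from d) (from p) → p ≡ a ⊎ p ≡ a ⊕ d ⊎ p ≡ (a ⊕ d) ⊕ d
    line⁻ (inj₁ eq)        = inj₁ (from-injective eq)
    line⁻ (inj₂ (inj₁ eq)) = inj₂ (inj₁ (from-injective (trans eq (sym (from-⊕ _ _)))))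
    line⁻ (inj₂ (inj₂ eq)) = inj₂ (inj₂ (from-injective (trans eq (sym (from-⊕⊕ _ _)))))

    line⁺ : ∀ {a d p} → p ≡ a ⊎ p ≡ a ⊕ d ⊎ p ≡ (a ⊕ d) ⊕ d → Line (from a) (from d) (from p)
    line⁺ (inj₁ eq)        = inj₁ (cong from eq)
    line⁺ (inj₂ (inj₁ eq)) = inj₂ (inj₁ (trans (cong from eq) (from-⊕ _ _)))
    line⁺ (inj₂ (inj₂ eq)) = inj₂ (inj₂ (trans (cong from eq) (from-⊕⊕ _ _)))

    isLine : ∀ {b} → IsLineSubset b → IsLine h (λ p → from p ∈ b)
    isLine (a , u , u≢o , b⇒line , line⇒b)
      -- Writing `a` and `u` as values of `from` brings the line into the form that `line⁻` and
      -- `line⁺` expect.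
      rewrite sym (strictlyInverseʳ a) | sym (strictlyInverseʳ u) =
        to a , to u , (λ eq → u≢o (trans (cong from eq) from-𝟎))
      , λ p → line⁻ ∘ b⇒line , line⇒b ∘ line⁺

    isLineSubset : ∀ {b} → IsLine h (λ p → from p ∈ b) → IsLineSubset b
    isLineSubset {b} (a , d , d≢𝟎 , points) =
        from a , from d , (λ eq → d≢𝟎 (from-injective (trans eq (sym from-𝟎))))
      , (λ {z} z∈ → subst (Line (from a) (from d)) (strictlyInverseʳ z)
          (line⁺ (proj₁ (points (to z)) (subst (_∈ b) (sym (strictlyInverseʳ z)) z∈))))
      , (λ {z} on → subst (_∈ b) (strictlyInverseʳ z)
          (proj₂ (points (to z)) (line⁻ (subst (Line (from a) (from d)) (sym (strictlyInverseʳ z)) on))))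

-- Parity from the two congruences, and conclusion.

odd-order : ∀ v → v % 6 ≡ 1 ⊎ v % 6 ≡ 3 → ¬ 2 ∣ v
odd-order v v%6 2∣v with %-presˡ-∣ 2∣v (divides 3 refl)
... | 2∣v%6 = case v%6
  where
  case : v % 6 ≡ 1 ⊎ v % 6 ≡ 3 → ⊥
  case (inj₁ eq) = from-no (2 ∣? 1) (subst (2 ∣_) eq 2∣v%6)
  case (inj₂ eq) = from-no (2 ∣? 3) (subst (2 ∣_) eq 2∣v%6)

-- Reduction modulo an even number preserves parity, and 6 is even. With `v` odd this makes `lam`
-- odd.
2∣modulus-transfer : ∀ v lam .{{_ : NonZero lam}} → v % lam ≡ 6 % lam → 2 ∣ lam → 2 ∣ v
2∣modulus-transfer v lam v≡6 2∣lam = subst (2 ∣_) (sym (m≡m%n+[m/n]*n v lam))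
  (∣m∣n⇒∣m+n (subst (2 ∣_) (sym v≡6) (%-presˡ-∣ (divides 3 refl) 2∣lam)) (∣n⇒∣m*n (v / lam) 2∣lam))

theorem1p7 : ∀ (v lam : ℕ) .{{_ : NonZero lam}} (D : Design v 3 lam) →
    NonTrivial v 3 →
    (v % 6 ≡ 1 ⊎ v % 6 ≡ 3) →
    v % lam ≡ 6 % lam →
    (G : PermGroup v) → IsAutGroup D G → FlagTransitive D G → TwoTransitive G →
    AffineType G →
    ∃[ h ] IsoAG3 D h
theorem1p7 v@(suc (suc _)) lam D _ v%6 v≡6 G aut flagTransitive twoTransitive
  (N , normal , regular , commute , _) =
  AffineDesign.isoAG3 D 2∤v (2∤v ∘ 2∣modulus-transfer v lam v≡6) G aut flagTransitive twoTransitive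
    -- The origin `o` and the second point `x₀` are arbitrary distinct points; non-triviality
    -- guarantees that the first two exist.
    N normal regular commute zero (suc zero) λ ()
  where
  2∤v : ¬ 2 ∣ v
  2∤v = odd-order v v%6
theorem1p7 zero _ _ (_ , ())
theorem1p7 (suc zero) _ _ (_ , s≤s ())
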